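{- Let $\mathbf{L}\in\{\mathbf{K},\mathbf{T},\mathbf{K4},\mathbf{S4}\}$ and let $\varphi$ be an $\mathbf{L}^{Horn,\Box}$-formula. (1) If $\mathbf{L}=\mathbf{K}$ (resp. $\mathbf{L}=\mathbf{T}$), then $\varphi$ is $\mathbf{L}$-satisfiable if and only if it is satisfiable in a pre-linear (resp. pre-linear reflexive) model $M$ with $|M|\le md(\varphi)+1$. (2) If $\mathbf{L}=\mathbf{K4}$ (resp. $\mathbf{L}=\mathbf{S4}$), then $\varphi$ is $\mathbf{L}$-satisfiable if and only if it is satisfiable in a pre-linear transitive (resp. pre-linear transitive and reflexive) model $M$ with $|M|\le|\varphi|$.
   Context: Fix a countable set $\mathcal P$ of propositional letters; Kripke models $((W,R),V)$ with $V:W\to2^{\mathcal P}$ and standard modal satisfaction; $|M|$ is the number of worlds of $M$. $\mathbf{K},\mathbf{T},\mathbf{K4},\mathbf{S4}$ are interpreted over all, reflexive, transitive, and reflexive-transitive frames respectively; $\varphi$ is $\mathbf{L}$-satisfiable if it holds at some world of some model over a frame in the class of $\mathbf{L}$. $|\varphi|$ is the number of symbols of $\varphi$ and $md(\varphi)$ its modal depth (maximum nesting of modal operators). Box positive literals: $\lambda::=\top\mid p\mid\Box\lambda$. An $\mathbf{L}^{Horn,\Box}$-formula is a finite conjunction of clauses $\Box^s(\neg\lambda_1\vee\dots\vee\neg\lambda_n\vee\lambda_{n+1}\vee\dots\vee\lambda_{n+m})$ with $s,n\ge0$, $m\le1$, $\lambda_i$ box positive literals. A frame $(W,R)$ is pre-linear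 if there is a unique world $w_0$ (root) with $w_0R^*w$ for all $w\in W$ ($R^*$ the reflexive-transitive closure) and every world has at most one $R$-successor; a pre-linear model is a model on such a frame. Pre-linear reflexive (resp. transitive, transitive and reflexive) models are obtained from pre-linear models by replacing $R$ with its reflexive closure (resp. transitive closure, reflexive-transitive closure). -}

module Defs where

open import Level using (0ℓ)
open import Data.Nat using (ℕ; zero; suc; _+_; _⊔_; _≤_)
open import Data.Fin using (Fin)
open import Data.List using (List; []; _∷_; map; _++_)
open import Data.Maybe using (Maybe; just; nothing)
open import Data.Product using (Σ; ∃; _×_; _,_)
open import Data.Sum using (_⊎_)
open import Data.Unit using (⊤)
open import Data.Empty using (⊥)
open import Relation.Nullary using (¬_)
open import Relation.Binary using (Rel; Reflexive; Transitive)
open import Relation.Binary.PropositionalEquality using (_≡_)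
open import Relation.Binary.Construct.Closure.Reflexive using (ReflClosure)
open import Relation.Binary.Construct.Closure.Transitive using (TransClosure)
open import Relation.Binary.Construct.Closure.ReflexiveTransitive using (Star)

data Fm : Set where
  ⊤'  : Fm
  ⊥'  : Fm
  var : ℕ → Fm
  ¬'_ : Fm → Fm
  _∧'_ : Fm → Fm → Fm
  _∨'_ : Fm → Fm → Fm
  □_  : Fm → Fm

size : Fm → ℕ
size ⊤' = 1
size ⊥' = 1
size (var _) = 1
size (¬' φ) = suc (size φ)
size (φ ∧' ψ) = suc (size φ + size ψ)
size (φ ∨' ψ) = suc (size φ + size ψ)
size (□ φ) = suc (size φ)

md : Fm → ℕ
md ⊤' = 0
md ⊥' = 0
md (var _) = 0
md (¬' φ) = md φ
md (φ ∧' ψ) = md φ ⊔ md ψ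
md (φ ∨' ψ) = md φ ⊔ md ψ
md (□ φ) = suc (md φ)

□^ : ℕ → Fm → Fm
□^ zero φ = φ
□^ (suc s) φ = □ (□^ s φ)

⋁ : List Fm → Fm
⋁ [] = ⊥'
⋁ (φ ∷ []) = φ
⋁ (φ ∷ ψ ∷ ψs) = φ ∨' ⋁ (ψ ∷ ψs)

⋀ : List Fm → Fm
⋀ [] = ⊤'
⋀ (φ ∷ []) = φ
⋀ (φ ∷ ψ ∷ ψs) = φ ∧' ⋀ (ψ ∷ ψs)

data BPLit : Set where
  top : BPLit
  lit : ℕ → BPLit
  box : BPLit → BPLit

⟦_⟧λ : BPLit → Fm
⟦ top ⟧λ = ⊤'
⟦ lit p ⟧λ = var p
⟦ box λ' ⟧λ = □ ⟦ λ' ⟧λ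

record Clause : Set where
  constructor clause
  field
    boxes : ℕ
    negs  : List BPLit
    pos   : Maybe BPLit

posList : Maybe BPLit → List Fm
posList nothing = []
posList (just λ') = ⟦ λ' ⟧λ ∷ []

⟦_⟧c : Clause → Fm
⟦ clause s ns p ⟧c = □^ s (⋁ (map (λ λ' → ¬' ⟦ λ' ⟧λ) ns ++ posList p))

HornBox : Set
HornBox = List Clause

⟦_⟧h : HornBox → Fm
⟦ cs ⟧h = ⋀ (map ⟦_⟧c cs)

record Model : Set₁ where
  constructor model
  field
    W : Set
    R : Rel W 0ℓ
    V : W → ℕ → Set

open Model public

_,_⊨_ : (M : Model) → W M → Fm → Set
M , w ⊨ ⊤' = ⊤
M , w ⊨ ⊥' = ⊥
M , w ⊨ var p = V M w p
M , w ⊨ (¬' φ) = ¬ (M , w ⊨ φ)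
M , w ⊨ (φ ∧' ψ) = (M , w ⊨ φ) × (M , w ⊨ ψ)
M , w ⊨ (φ ∨' ψ) = (M , w ⊨ φ) ⊎ (M , w ⊨ ψ)
M , w ⊨ (□ φ) = ∀ v → R M w v → M , v ⊨ φ

data Logic : Set where
  K T K4 S4 : Logic

FrameCond : Logic → {W : Set} → Rel W 0ℓ → Set
FrameCond K  R = ⊤
FrameCond T  R = Reflexive R
FrameCond K4 R = Transitive R
FrameCond S4 R = Reflexive R × Transitive R

Satisfiable : Logic → Fm → Set₁
Satisfiable L φ = Σ Model λ M → FrameCond L (R M) × Σ (W M) λ w → M , w ⊨ φ

PreLinear : {W : Set} → Rel W 0ℓ → Set
PreLinear {W} R =
  (Σ W λ w₀ → (∀ w → Star R w₀ w) × (∀ w₁ → (∀ w → Star R w₁ w) → w₁ ≡ w₀))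
  × (∀ w v v′ → R w v → R w v′ → v ≡ v′)

-- The closure applied to a pre-linear frame to get the L-variant:
-- K: none; T: reflexive; K4: transitive; S4: reflexive-transitive.
closeL : Logic → {W : Set} → Rel W 0ℓ → Rel W 0ℓ
closeL K  R = R
closeL T  R = ReflClosure R
closeL K4 R = TransClosure R
closeL S4 R = Star R

PreLinSatBounded : Logic → Fm → ℕ → Set₁
PreLinSatBounded L φ k =
  Σ ℕ λ n → n ≤ k ×
  Σ (Rel (Fin n) 0ℓ) λ R → PreLinear R ×
  Σ (Fin n → ℕ → Set) λ V → Σ (Fin n) λ w → model (Fin n) (closeL L R) V , w ⊨ φ

bound : Logic → Fm → ℕ
bound K  φ = suc (md φ)
bound T  φ = suc (md φ)
bound K4 φ = size φ
bound S4 φ = size φ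

module Submission where

-- Fix a model of φ at w and let level i be the set of worlds at distance i from w.  Merging each level
-- into a single world that keeps the letters common to the level preserves φ: a box positive literal
-- is true at the merged world iff it is true throughout the level, so every Horn clause survives.
-- For K the resulting chain is cut at depth md φ or at its last inhabited level; over reflexive frames
-- the letters decrease along the levels, and for S4 levels 1, 2, … coincide.
-- Over transitive frames the letters increase along the levels from 1 on, so the chain can end in a dead end
-- or in a loop at a level where the letters have stabilised.  A clause prevents the deletion of at most
-- a₁ + … + aₙ levels, where the □^aᵢ pᵢ are its negated literals; since these numbers add up to less than |φ|,
-- levels can be deleted until at most |φ| are left.
-- It is not decidable what holds throughout a level, so all of this happens under a double negation,
-- which is removed at the end because a bounded chain model can be found by finite search.

open import Defs
open import Level using (0ℓ)
open import Data.Nat using (ℕ; zero; suc; _+_; _⊔_; _⊓_; _≤_; _<_; z≤n; s≤s; s≤s⁻¹; _<?_; _≤?_; _≟_)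
open import Data.Nat.Properties
open import Data.Bool using (Bool; true; false) renaming (T to True)
open import Data.Fin using (Fin; zero; suc; toℕ; fromℕ<)
open import Data.Fin.Properties using (toℕ<n; toℕ≤pred[n]; toℕ-fromℕ<; toℕ-injective; injective⇒≤) renaming (all? to allFin?; any? to anyFin?)
open import Data.List using (List; []; _∷_; map; _++_; length; upTo)
open import Data.List.Properties using (length-map; length-upTo; length-++)
open import Data.List.Relation.Unary.Any using (here; there)
open import Data.List.Relation.Unary.Any.Properties using (lookup-index)
open import Data.List.Relation.Unary.All as All using ()
open import Data.List.Relation.Unary.All.Properties using (¬All⇒Any¬)
open import Data.List.Membership.Propositional using (_∈_; _∉_; find)
open import Data.List.Membership.Propositional.Properties using (∈-map⁺; ∈-map⁻; ∈-++⁺ˡ; ∈-++⁺ʳ; ∈-++⁻; ∈-upTo⁺)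
open import Data.List.Membership.DecPropositional _≟_ using (_∈?_)
open import Data.Nat.ListAction using (sum)
open import Data.Maybe using (Maybe; just; nothing)
open import Data.Product using (Σ; _×_; _,_; proj₁; proj₂)
open import Data.Sum using (_⊎_; inj₁; inj₂; [_,_]′)
open import Data.Unit using (⊤; tt)
open import Data.Empty using (⊥; ⊥-elim)
open import Data.Vec using (Vec; []; _∷_; lookup; tabulate)
open import Data.Vec.Properties using (lookup∘tabulate)
open import Function using (_∘_; id)
open import Function.Bundles using (_⇔_; mk⇔; Equivalence)
open import Function.Properties.Equivalence using () renaming (refl to ⇔-refl; sym to ⇔-sym; trans to ⇔-trans)
open import Relation.Nullary using (¬_; Dec; yes; no; ⌊_⌋; contradiction)
open import Relation.Nullary.Decidable using (map′; T?; ¬?; _×-dec_; _⊎-dec_; _→-dec_; ¬¬-excluded-middle; toWitness; fromWitness; decidable-stable) renaming (map to map-dec)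
open import Relation.Binary using (Rel; Reflexive; Transitive; tri<; tri≈; tri>)
open import Relation.Binary.PropositionalEquality using (_≡_; refl; sym; trans; cong; subst; subst₂)
open import Relation.Binary.Construct.Closure.Reflexive as Refl using ()
open import Relation.Binary.Construct.Closure.Transitive as Trans using (TransClosure)
open import Relation.Binary.Construct.Closure.ReflexiveTransitive using (Star; ε; _◅_; _◅◅_)

open Equivalence using (to; from)

-- Double negation over bounded ranges, and a pigeonhole principle

¬¬-∀< : ∀ n {Q : ℕ → Set} → (∀ i → i < n → ¬ ¬ Q i) → ¬ ¬ (∀ i → i < n → Q i)
¬¬-∀< zero    q k = k λ _ ()
¬¬-∀< (suc n) q k = ¬¬-∀< n (λ i i<n → q i (m≤n⇒m≤1+n i<n)) λ below →
  q n ≤-refl λ qn → k λ i i<1+n → [ below i , (λ { refl → qn }) ]′ (m≤n⇒m<n∨m≡n (s≤s⁻¹ i<1+n))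

-- Only the finitely many instances below `N` are in doubt, and double negation commutes with a
-- bounded universal quantifier.
¬¬-Dec : ∀ N {Q : ℕ → Set} → (∀ p → N ≤ p → Q p) → ¬ ¬ (∀ p → Dec (Q p))
¬¬-Dec N above k = ¬¬-∀< N (λ _ _ → ¬¬-excluded-middle) λ below → k λ p → decide below p
  where
  decide : (∀ p → p < N → Dec _) → ∀ p → Dec _
  decide below p with p <? N
  ... | yes p<N = below p p<N
  ... | no  p≮N = yes (above p (≮⇒≥ p≮N))

∃-∉ : ∀ e (xs : List ℕ) → length xs < e → Σ ℕ λ g → 1 ≤ g × g ≤ e × g ∉ xs
∃-∉ e xs ∣xs∣<e with anyFin? {e} (λ i → ¬? (suc (toℕ i) ∈? xs))
... | yes (i , i∉xs) = suc (toℕ i) , s≤s z≤n , toℕ<n i , i∉xs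
-- If all of 1, ..., `e` occurred in `xs`, their positions would inject `Fin e` into fewer than `e`
-- places.
... | no  all∈ = ⊥-elim (<⇒≱ ∣xs∣<e (injective⇒≤ λ {i} {j} eq →
        toℕ-injective (suc-injective (trans (lookup-index (mem i))
          (trans (cong (Data.List.lookup xs) eq) (sym (lookup-index (mem j))))))))
  where
  mem : (i : Fin e) → suc (toℕ i) ∈ xs
  mem i = decidable-stable (suc (toℕ i) ∈? xs) λ i∉xs → all∈ (i , i∉xs)

-- Satisfaction

module _ {M : Model} {w : W M} where

  ⋁⁺ : ∀ {ψ} φs → ψ ∈ φs → M , w ⊨ ψ → M , w ⊨ ⋁ φs
  ⋁⁺ (φ ∷ [])     (here refl) sat = sat
  ⋁⁺ (φ ∷ χ ∷ φs) (here refl) sat = inj₁ sat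
  ⋁⁺ (φ ∷ χ ∷ φs) (there ψ∈)  sat = inj₂ (⋁⁺ (χ ∷ φs) ψ∈ sat)

  ⋁⁻ : ∀ φs → M , w ⊨ ⋁ φs → Σ Fm λ ψ → ψ ∈ φs × (M , w ⊨ ψ)
  ⋁⁻ (φ ∷ [])     sat        = φ , here refl , sat
  ⋁⁻ (φ ∷ χ ∷ φs) (inj₁ sat) = φ , here refl , sat
  ⋁⁻ (φ ∷ χ ∷ φs) (inj₂ sat) with ⋁⁻ (χ ∷ φs) sat
  ... | ψ , ψ∈ , sat′ = ψ , there ψ∈ , sat′

  ⋀⁺ : ∀ φs → (∀ {ψ} → ψ ∈ φs → M , w ⊨ ψ) → M , w ⊨ ⋀ φs
  ⋀⁺ []           sat = tt
  ⋀⁺ (φ ∷ [])     sat = sat (here refl)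
  ⋀⁺ (φ ∷ χ ∷ φs) sat = sat (here refl) , ⋀⁺ (χ ∷ φs) (sat ∘ there)

  ⋀⁻ : ∀ φs → M , w ⊨ ⋀ φs → ∀ {ψ} → ψ ∈ φs → M , w ⊨ ψ
  ⋀⁻ (φ ∷ [])     sat       (here refl) = sat
  ⋀⁻ (φ ∷ χ ∷ φs) (sat , _) (here refl) = sat
  ⋀⁻ (φ ∷ χ ∷ φs) (_ , sat) (there ψ∈)  = ⋀⁻ (χ ∷ φs) sat ψ∈

disj : List BPLit → Maybe BPLit → Fm
disj ns p = ⋁ (map (λ λ′ → ¬' ⟦ λ′ ⟧λ) ns ++ posList p)

-- A strict upper bound on the indices of the occurring letters, not their number.
vars : Fm → ℕ
vars ⊤'       = 0
vars ⊥'       = 0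
vars (var p)  = suc p
vars (¬' φ)   = vars φ
vars (φ ∧' ψ) = vars φ ⊔ vars ψ
vars (φ ∨' ψ) = vars φ ⊔ vars ψ
vars (□ φ)    = vars φ

⊨-cong : ∀ {W : Set} {R : Rel W 0ℓ} {V V′ : W → ℕ → Set} N →
  (∀ w p → p < N → V w p ⇔ V′ w p) →
  ∀ φ → vars φ ≤ N → ∀ {w} → (model W R V , w ⊨ φ) ⇔ (model W R V′ , w ⊨ φ)
⊨-cong N eq ⊤' _ = ⇔-refl
⊨-cong N eq ⊥' _ = ⇔-refl
⊨-cong N eq (var p) p<N = eq _ p p<N
⊨-cong N eq (¬' φ) v = let IH = ⊨-cong N eq φ v in mk⇔ (_∘ from IH) (_∘ to IH)
⊨-cong N eq (φ ∧' ψ) v =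
  let IH₁ = ⊨-cong N eq φ (m⊔n≤o⇒m≤o (vars φ) _ v)
      IH₂ = ⊨-cong N eq ψ (m⊔n≤o⇒n≤o (vars φ) _ v)
  in mk⇔ (λ (a , b) → to IH₁ a , to IH₂ b) (λ (a , b) → from IH₁ a , from IH₂ b)
⊨-cong N eq (φ ∨' ψ) v =
  let IH₁ = ⊨-cong N eq φ (m⊔n≤o⇒m≤o (vars φ) _ v)
      IH₂ = ⊨-cong N eq ψ (m⊔n≤o⇒n≤o (vars φ) _ v)
  in mk⇔ [ inj₁ ∘ to IH₁ , inj₂ ∘ to IH₂ ]′ [ inj₁ ∘ from IH₁ , inj₂ ∘ from IH₂ ]′
⊨-cong N eq (□ φ) v = mk⇔ (λ sat u Rwu → to (⊨-cong N eq φ v) (sat u Rwu))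
                          (λ sat u Rwu → from (⊨-cong N eq φ v) (sat u Rwu))

⊨-dec : ∀ {n} {R : Rel (Fin n) 0ℓ} {V : Fin n → ℕ → Set} →
  (∀ i j → Dec (R i j)) → (∀ i p → Dec (V i p)) → ∀ w φ → Dec (model (Fin n) R V , w ⊨ φ)
⊨-dec R? V? w ⊤'       = yes tt
⊨-dec R? V? w ⊥'       = no λ ()
⊨-dec R? V? w (var p)  = V? w p
⊨-dec R? V? w (¬' φ)   = ¬? (⊨-dec R? V? w φ)
⊨-dec R? V? w (φ ∧' ψ) = ⊨-dec R? V? w φ ×-dec ⊨-dec R? V? w ψ
⊨-dec R? V? w (φ ∨' ψ) = ⊨-dec R? V? w φ ⊎-dec ⊨-dec R? V? w ψ
⊨-dec R? V? w (□ φ)    = allFin? λ v → R? w v →-dec ⊨-dec R? V? v φ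

Searchable : Set → Set₁
Searchable A = {Q : A → Set} → (∀ x → Dec (Q x)) → Dec (Σ A Q)

search-Bool : Searchable Bool
search-Bool Q? = map′ [ (true ,_) , (false ,_) ]′ (λ { (true , q) → inj₁ q ; (false , q) → inj₂ q })
                      (Q? true ⊎-dec Q? false)

search-Vec : ∀ {A} → Searchable A → ∀ n → Searchable (Vec A n)
search-Vec s zero    Q? = map′ ([] ,_) (λ { ([] , q) → q }) (Q? [])
search-Vec s (suc n) Q? = map′ (λ (x , xs , q) → x ∷ xs , q) (λ { (x ∷ xs , q) → x , xs , q })
                               (s λ x → search-Vec s n λ xs → Q? (x ∷ xs))

-- The last step is split off, so that a world at distance `suc i` comes with a predecessor at
-- distance `i`. Since `□^` splits off the outermost box instead, `□^-suc` reconciles the two.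
Steps : ∀ {W : Set} → Rel W 0ℓ → ℕ → W → W → Set
Steps R zero    w v = w ≡ v
Steps R (suc i) w v = Σ _ λ u → Steps R i w u × R u v

□^-suc : ∀ s φ → □^ (suc s) φ ≡ □^ s (□ φ)
□^-suc zero    φ = refl
□^-suc (suc s) φ = cong □_ (□^-suc s φ)

⊨□^ : ∀ {M w} s φ → (M , w ⊨ □^ s φ) ⇔ (∀ v → Steps (R M) s w v → M , v ⊨ φ)
⊨□^ zero    φ = mk⇔ (λ { sat _ refl → sat }) (λ sat → sat _ refl)
⊨□^ {M} {w} (suc s) φ =
  subst (λ ψ → (M , w ⊨ ψ) ⇔ (∀ v → Steps (R M) (suc s) w v → M , v ⊨ φ)) (sym (□^-suc s φ))
    (⇔-trans (⊨□^ s (□ φ)) (mk⇔ (λ sat v (u , st , Ruv) → sat u st v Ruv)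
                                (λ sat u st v Ruv → sat v (u , st , Ruv))))

-- Levels

Letters : Set₁
Letters = ℕ → ℕ → Set

-- Level i of a model generated at w is the set of worlds at distance i.  Merging every level into
-- one world keeps exactly the letters common to its worlds; lev P i λ′ says that λ′ holds throughout level i.
lev : Letters → ℕ → BPLit → Set
lev P i top      = ⊤
lev P i (lit p)  = P i p
lev P i (box λ′) = lev P (suc i) λ′

depth : BPLit → ℕ
depth λ′ = md ⟦ λ′ ⟧λ

-- The levels at which a clause under `s` boxes is evaluated: worlds at distance `i` are reachable
-- in exactly `s` steps, because reflexive steps can be inserted (T, S4) and consecutive steps
-- merged down to a single one (K4, S4).
Range : Logic → ℕ → ℕ → Set
Range K  s i = i ≡ s
Range T  s i = i ≤ s
Range K4 s i = (s ≡ 0 × i ≡ 0) ⊎ (1 ≤ s × s ≤ i)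
Range S4 s i = s ≡ 0 → i ≡ 0

-- `N` marks the inhabited levels: a headless clause whose body holds throughout a level forces that
-- level to be empty.
Head : Letters → (ℕ → Set) → ℕ → Maybe BPLit → Set
Head P N i nothing   = ¬ N i
Head P N i (just λ′) = lev P i λ′

ClauseAt : Letters → (ℕ → Set) → ℕ → Clause → Set
ClauseAt P N i c = (∀ {λ′} → λ′ ∈ Clause.negs c → lev P i λ′) → Head P N i (Clause.pos c)

HornLev : Logic → HornBox → Letters → (ℕ → Set) → Set
HornLev L h P N = ∀ {c} → c ∈ h → ∀ i → Range L (Clause.boxes c) i → ClauseAt P N i c

-- A literal with `d` boxes, evaluated at level `i`, consults no letters but those of level `d + i`.
lev-map : ∀ {P Q : Letters} {i j} λ′ →
  (∀ p → P (depth λ′ + i) p → Q (depth λ′ + j) p) → lev P i λ′ → lev Q j λ′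
lev-map top      f x = tt
lev-map (lit p)  f x = f p x
lev-map {P} {Q} {i} {j} (box λ′) f x =
  lev-map λ′ (λ p → subst₂ (λ m n → P m p → Q n p) (sym (+-suc (depth λ′) i)) (sym (+-suc (depth λ′) j)) (f p)) x

lev-dec : ∀ {P} → (∀ i p → Dec (P i p)) → ∀ i λ′ → Dec (lev P i λ′)
lev-dec P? i top      = yes tt
lev-dec P? i (lit p)  = P? i p
lev-dec P? i (box λ′) = lev-dec P? (suc i) λ′

-- Finite chains

Edge : ℕ → Bool → ℕ → ℕ → Set
Edge e b i j = j ≡ suc i ⊎ (True b × i ≡ e × j ≡ e)

chain : ∀ e → Bool → Rel (Fin (suc e)) 0ℓ
chain e b i j = Edge e b (toℕ i) (toℕ j)

-- Arithmetic forms of the closures of the chain, which make accessibility decidable; `closeL⇔Acc`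
-- identifies the two.
Acc : Logic → ℕ → Bool → ℕ → ℕ → Set
Acc K  e b i j = Edge e b i j
Acc T  e b i j = i ≡ j ⊎ Edge e b i j
Acc K4 e b i j = i < j ⊎ (True b × i ≡ e × j ≡ e)
Acc S4 e b i j = i ≤ j

Edge? : ∀ e b i j → Dec (Edge e b i j)
Edge? e b i j = (j ≟ suc i) ⊎-dec (T? b ×-dec (i ≟ e) ×-dec (j ≟ e))

Acc? : ∀ L e b i j → Dec (Acc L e b i j)
Acc? K  e b i j = Edge? e b i j
Acc? T  e b i j = (i ≟ j) ⊎-dec Edge? e b i j
Acc? K4 e b i j = (i <? j) ⊎-dec (T? b ×-dec (i ≟ e) ×-dec (j ≟ e))
Acc? S4 e b i j = i ≤? j

Edge⇒≤ : ∀ {e b i j} → Edge e b i j → i ≤ j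
Edge⇒≤ (inj₁ refl)              = n≤1+n _
Edge⇒≤ (inj₂ (_ , refl , refl)) = ≤-refl

Star⇒≤ : ∀ {e b i j} → Star (chain e b) i j → toℕ i ≤ toℕ j
Star⇒≤ ε        = ≤-refl
Star⇒≤ (r ◅ rs) = ≤-trans (Edge⇒≤ r) (Star⇒≤ rs)

≤⇒Star : ∀ {e b} d (i j : Fin (suc e)) → toℕ j ≡ d + toℕ i → Star (chain e b) i j
≤⇒Star zero    i j eq = subst (Star _ i) (sym (toℕ-injective eq)) ε
≤⇒Star {e} (suc d) i j eq = inj₁ (toℕ-fromℕ< i+1<) ◅ ≤⇒Star d next j
    (trans eq (trans (sym (+-suc d (toℕ i))) (cong (d +_) (sym (toℕ-fromℕ< i+1<)))))
  where
  i+1< : suc (toℕ i) < suc e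
  i+1< = ≤-<-trans (s≤s (m≤n+m (toℕ i) d)) (subst (_< suc e) eq (toℕ<n j))
  next : Fin (suc e)
  next = fromℕ< i+1<

Acc⇒Trans : ∀ {e b} d (i j : Fin (suc e)) → toℕ j ≡ suc d + toℕ i → TransClosure (chain e b) i j
Acc⇒Trans zero    i j eq = Trans.[ inj₁ eq ]
Acc⇒Trans {e} (suc d) i j eq = inj₁ (toℕ-fromℕ< i+1<) Trans.∷ Acc⇒Trans d (fromℕ< i+1<) j
    (trans eq (trans (cong suc (sym (+-suc d (toℕ i)))) (cong (suc d +_) (sym (toℕ-fromℕ< i+1<)))))
  where
  i+1< : suc (toℕ i) < suc e
  i+1< = ≤-<-trans (s≤s (m≤n+m (toℕ i) (suc d))) (subst (_< suc e) eq (toℕ<n j))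

Acc-trans : ∀ {e b i j k} → Edge e b i j → Acc K4 e b j k → Acc K4 e b i k
Acc-trans (inj₁ refl)              (inj₁ j<k)                = inj₁ (<-trans ≤-refl j<k)
Acc-trans (inj₁ refl)              (inj₂ (_ , refl , refl))  = inj₁ ≤-refl
Acc-trans (inj₂ (_ , refl , refl)) r                         = r

≤⇒∃ : ∀ {i j} → i ≤ j → Σ ℕ λ d → j ≡ d + i
≤⇒∃ {i} i≤j with m≤n⇒∃[o]m+o≡n i≤j
... | d , eq = d , trans (sym eq) (+-comm i d)

closeL⇔Acc : ∀ L {e b} {i j : Fin (suc e)} → closeL L (chain e b) i j ⇔ Acc L e b (toℕ i) (toℕ j)
closeL⇔Acc K  = ⇔-refl
closeL⇔Acc T  = mk⇔ (λ { Refl.refl → inj₁ refl ; Refl.[ r ] → inj₂ r })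
                    [ (λ eq → Refl.reflexive (toℕ-injective eq)) , Refl.[_] ]′
closeL⇔Acc K4 = mk⇔ trans⇒ acc⇒
  where
  trans⇒ : ∀ {e b i j} → TransClosure (chain e b) i j → Acc K4 e b (toℕ i) (toℕ j)
  trans⇒ Trans.[ inj₁ eq ] = inj₁ (≤-reflexive (sym eq))
  trans⇒ Trans.[ inj₂ r ]  = inj₂ r
  trans⇒ (r Trans.∷ rs)    = Acc-trans r (trans⇒ rs)
  acc⇒ : ∀ {e b} {i j : Fin (suc e)} → Acc K4 e b (toℕ i) (toℕ j) → TransClosure (chain e b) i j
  acc⇒ (inj₁ i<j) with ≤⇒∃ i<j
  ... | d , eq = Acc⇒Trans d _ _ (trans eq (+-suc d _))
  acc⇒ (inj₂ r) = Trans.[ inj₂ r ]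
closeL⇔Acc S4 = mk⇔ Star⇒≤ λ i≤j → let (d , eq) = ≤⇒∃ i≤j in ≤⇒Star d _ _ eq

-- Edges never lower the index, so only 0 reaches 0. The loop sits at the last world, whose other
-- successor would lie outside the chain.
chain-preLinear : ∀ e b → PreLinear (chain e b)
chain-preLinear e b = (zero , from-zero , unique) , functional
  where
  from-zero : ∀ w → Star (chain e b) zero w
  from-zero w = ≤⇒Star (toℕ w) zero w (sym (+-identityʳ (toℕ w)))
  unique : ∀ w → (∀ v → Star (chain e b) w v) → w ≡ zero
  unique w root = toℕ-injective (n≤0⇒n≡0 (Star⇒≤ (root zero)))
  functional : ∀ w v v′ → chain e b w v → chain e b w v′ → v ≡ v′
  functional w v v′ (inj₁ p) (inj₁ q) = toℕ-injective (trans p (sym q))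
  functional w v v′ (inj₁ p) (inj₂ (_ , q , _)) =
    contradiction (trans p (cong suc q)) (<⇒≢ (toℕ<n v))
  functional w v v′ (inj₂ (_ , q , _)) (inj₁ p) =
    contradiction (trans p (cong suc q)) (<⇒≢ (toℕ<n v′))
  functional w v v′ (inj₂ (_ , _ , p)) (inj₂ (_ , _ , q)) = toℕ-injective (trans p (sym q))

-- Going round the loop unfolds the chain into infinitely many levels.
Inhabited : ℕ → Bool → ℕ → Set
Inhabited e b i = True b ⊎ i ≤ e

-- The sequence `P` is infinite although the chain ends at `e`, since `lev` looks past the end;
-- `successor` makes a box on the finite chain agree with one step along the sequence.
record ChainLevels (L : Logic) (h : HornBox) (e : ℕ) (b : Bool) : Set₁ where
  field
    P        : Letters
    P?       : ∀ i p → Dec (P i p)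
    successor : ∀ j → j ≤ e → ∀ λ′ →
      (∀ k → k ≤ e → Acc L e b j k → lev P k λ′) ⇔ lev P (suc j) λ′
    -- A world of the chain that is reachable in s steps represents some level in the range of □^s.
    represents : ∀ s (j : Fin (suc e)) → Steps (closeL L (chain e b)) s zero j →
      Σ ℕ λ i → Range L s i × Inhabited e b i × (∀ λ′ → lev P (toℕ j) λ′ ⇔ lev P i λ′)
    horn : HornLev L h P (Inhabited e b)

module _ {L h e b} (C : ChainLevels L h e b) where
  open ChainLevels C

  private
    M′ : Model
    M′ = model (Fin (suc e)) (closeL L (chain e b)) (λ j → P (toℕ j))

  chain-truth : ∀ λ′ (j : Fin (suc e)) → (M′ , j ⊨ ⟦ λ′ ⟧λ) ⇔ lev P (toℕ j) λ′
  chain-truth top      j = ⇔-refl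
  chain-truth (lit p)  j = ⇔-refl
  chain-truth (box λ′) j = ⇔-trans (mk⇔
    (λ sat k k≤e jRk → subst (λ n → lev P n λ′) (toℕ-fromℕ< (s≤s k≤e))
       (to (chain-truth λ′ _) (sat (fromℕ< (s≤s k≤e))
         (from (closeL⇔Acc L) (subst (Acc L e b (toℕ j)) (sym (toℕ-fromℕ< (s≤s k≤e))) jRk)))))
    (λ l k jRk → from (chain-truth λ′ k) (l (toℕ k) (toℕ≤pred[n] k) (to (closeL⇔Acc L) jRk))))
    (successor (toℕ j) (toℕ≤pred[n] j) λ′)

  chain-sat : M′ , zero ⊨ ⟦ h ⟧h
  chain-sat = ⋀⁺ (map ⟦_⟧c h) λ ψ∈ → sat-clause (∈-map⁻ ⟦_⟧c ψ∈)
    where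
    sat-clause : ∀ {ψ} → Σ Clause (λ c → c ∈ h × ψ ≡ ⟦ c ⟧c) → M′ , zero ⊨ ψ
    sat-clause (clause s ns pos , c∈h , refl) = from (⊨□^ s _) disjunction
      where
      disjunction : ∀ v → Steps (closeL L (chain e b)) s zero v →
        M′ , v ⊨ disj ns pos
      -- Either some negated literal fails at the representing level and yields the true disjunct,
      -- or the whole body holds there and the clause yields its head.
      disjunction v st with represents s v st
      ... | i , i∈range , inh , same with All.all? (lev-dec P? i) ns
      ...   | no ¬all with find (¬All⇒Any¬ (lev-dec P? i) ns ¬all)
      ...     | λ′ , λ∈ , ¬lev = ⋁⁺ _ (∈-++⁺ˡ (∈-map⁺ _ λ∈))
                  (λ sat → ¬lev (to (same λ′) (to (chain-truth λ′ v) sat)))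
      disjunction v st | i , i∈range , inh , same | yes all = head pos (horn c∈h i i∈range (All.lookup all))
        where
        head : ∀ pos → Head P (Inhabited e b) i pos →
          M′ , v ⊨ disj ns pos
        head nothing   ¬inh = ⊥-elim (¬inh inh)
        head (just λ′) l    = ⋁⁺ _ (∈-++⁺ʳ (map _ ns) (here refl))
                                (from (chain-truth λ′ v) (from (same λ′) l))

-- Decidability of satisfaction in bounded chains

⟪_⟫ : ∀ {m N} → Vec (Vec Bool N) m → Fin m → ℕ → Set
-- A letter from `N` on is vacuously true, so a finite table describes the whole valuation.
⟪_⟫ {N = N} vs j p = (p<N : p < N) → True (lookup (lookup vs j) (fromℕ< p<N))

⟪⟫-dec : ∀ {m N} (vs : Vec (Vec Bool N) m) j p → Dec (⟪ vs ⟫ j p)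
⟪⟫-dec {N = N} vs j p with p <? N
... | yes p<N = map′ (λ x _ → x) (λ f → f p<N) (T? _)
... | no  p≮N = yes λ p<N → contradiction p<N p≮N

ChainSat : Logic → Fm → ℕ → Set
ChainSat L φ k = Σ (Fin k) λ e → Σ Bool λ b → Σ (Vec (Vec Bool (vars φ)) (suc (toℕ e))) λ vs →
  model (Fin (suc (toℕ e))) (closeL L (chain (toℕ e) b)) ⟪ vs ⟫ , zero ⊨ φ

-- Lengths, loops and tables range over finite sets, and truth in a finite model is decidable; this
-- is what finally removes the double negation.
chainSat? : ∀ L φ k → Dec (ChainSat L φ k)
chainSat? L φ k = anyFin? λ e → search-Bool λ b →
  search-Vec (search-Vec search-Bool (vars φ)) (suc (toℕ e)) λ vs →
    ⊨-dec (λ i j → map-dec (⇔-sym (closeL⇔Acc L)) (Acc? L (toℕ e) b (toℕ i) (toℕ j))) (⟪⟫-dec vs) zero φ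

chainSat⇒preLinSat : ∀ L φ {k} → ChainSat L φ k → PreLinSatBounded L φ k
chainSat⇒preLinSat L φ (e , b , vs , sat) =
  suc (toℕ e) , toℕ<n e , chain (toℕ e) b , chain-preLinear (toℕ e) b , ⟪ vs ⟫ , zero , sat

chainLevels⇒chainSat : ∀ {L h e b k} → e < k → ChainLevels L h e b → ChainSat L ⟦ h ⟧h k
chainLevels⇒chainSat {L} {h} {e} {b} {k} e<k C = aux (sym (toℕ-fromℕ< e<k)) C
  where
  φ = ⟦ h ⟧h
  -- The length is generalised because `e` and `toℕ (fromℕ< e<k)` are only propositionally equal.
  aux : ∀ {e′} → e′ ≡ toℕ (fromℕ< e<k) → ChainLevels L h e′ b → ChainSat L φ k
  aux refl C = fromℕ< e<k , b , vs , to (⊨-cong (vars φ) agree φ ≤-refl) (chain-sat C)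
    where
    open ChainLevels C
    row : Fin (suc (toℕ (fromℕ< e<k))) → Vec Bool (vars φ)
    row j = tabulate λ q → ⌊ P? (toℕ j) (toℕ q) ⌋
    vs = tabulate row
    entry : ∀ j p (p<N : p < vars φ) → lookup (lookup vs j) (fromℕ< p<N) ≡ ⌊ P? (toℕ j) p ⌋
    entry j p p<N = trans (cong (λ r → lookup r (fromℕ< p<N)) (lookup∘tabulate row j))
      (trans (lookup∘tabulate (λ q → ⌊ P? (toℕ j) (toℕ q) ⌋) (fromℕ< p<N)) (cong (λ q → ⌊ P? (toℕ j) q ⌋) (toℕ-fromℕ< p<N)))
    agree : ∀ j p → p < vars φ → P (toℕ j) p ⇔ ⟪ vs ⟫ j p
    agree j p p<N = mk⇔ (λ x p<N′ → subst True (sym (entry j p p<N′)) (fromWitness x))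
                        (λ f → toWitness {a? = P? (toℕ j) p} (subst True (entry j p p<N) (f p<N)))

-- Chains for K, T, S4 and K4

lev-suc : ∀ {P i} λ′ → (∀ d p → P (d + i) p → P (suc (d + i)) p) → lev P i λ′ → lev P (suc i) λ′
lev-suc {P} {i} λ′ f = lev-map λ′ λ p x → subst (λ m → P m p) (sym (+-suc (depth λ′) i)) (f (depth λ′) p x)

lev-pred : ∀ {P i} λ′ → (∀ d p → P (suc (d + i)) p → P (d + i) p) → lev P (suc i) λ′ → lev P i λ′
lev-pred {P} {i} λ′ f = lev-map λ′ λ p x → f (depth λ′) p (subst (λ m → P m p) (+-suc (depth λ′) i) x)

lev-above : ∀ {P e i} λ′ → (∀ k p → e < k → P k p) → e < i → lev P i λ′
lev-above top      above e<i = tt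
lev-above (lit p)  above e<i = above _ p e<i
lev-above (box λ′) above e<i = lev-above λ′ above (m≤n⇒m≤1+n e<i)

-- Boxes are vacuously true at the dead end `e`; `lev` agrees because every letter holds beyond `e`.
K-chain : ∀ {h e} (P : Letters) → (∀ i p → Dec (P i p)) → (∀ i p → e < i → P i p) →
  HornLev K h P (Inhabited e false) → ChainLevels K h e false
K-chain {h} {e} P P? above horn = record
  { P = P ; P? = P? ; horn = horn
  ; successor  = λ j j≤e λ′ → mk⇔ (next j j≤e λ′) λ { l _ _ (inj₁ refl) → l }
  ; represents = λ s j st → toℕ j , level s j st , inj₂ (toℕ≤pred[n] j) , λ _ → ⇔-refl
  }
  where
  next : ∀ j → j ≤ e → ∀ λ′ → (∀ k → k ≤ e → Acc K e false j k → lev P k λ′) → lev P (suc j) λ′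
  next j j≤e λ′ f with m≤n⇒m<n∨m≡n j≤e
  ... | inj₁ j<e  = f (suc j) j<e (inj₁ refl)
  ... | inj₂ refl = lev-above λ′ above ≤-refl
  level : ∀ s (j : Fin (suc e)) → Steps (chain e false) s zero j → toℕ j ≡ s
  level zero    j refl               = refl
  level (suc s) j (u , st , inj₁ eq) = trans eq (cong suc (level s u st))

-- The letters decrease, so truth at level `suc j` descends to every accessible level, none of which
-- lies beyond it. At the last world, constancy of the letters replaces the missing next world.
reflexive-successor : ∀ {L e} {P : Letters} → (∀ i p → P (suc i) p → P i p) →
  (∀ i p → e ≤ i → P i p → P (suc i) p) →
  (∀ j → Acc L e true j j) → (∀ j → Acc L e true j (suc j)) →
  (∀ j k → k ≤ e → Acc L e true j k → k ≤ suc j) →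
  ∀ j → j ≤ e → ∀ λ′ → (∀ k → k ≤ e → Acc L e true j k → lev P k λ′) ⇔ lev P (suc j) λ′
reflexive-successor {L} {e} {P} antitone constant acc-refl acc-suc acc-bound j j≤e λ′ =
  mk⇔ next λ l k k≤e jRk → descend (≤⇒∃ (acc-bound j k k≤e jRk)) l
  where
  next : (∀ k → k ≤ e → Acc L e true j k → lev P k λ′) → lev P (suc j) λ′
  next f with m≤n⇒m<n∨m≡n j≤e
  ... | inj₁ j<e  = f (suc j) j<e (acc-suc j)
  ... | inj₂ refl = lev-suc λ′ (λ d p → constant (d + e) p (m≤n+m e d)) (f e ≤-refl (acc-refl e))
  descend : ∀ {k i} → (Σ ℕ λ d → i ≡ d + k) → lev P i λ′ → lev P k λ′
  descend (zero , refl)  l = l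
  descend (suc d , refl) l = descend (d , refl) (lev-pred λ′ (λ d p → antitone _ p) l)

T-chain : ∀ {h e} (P : Letters) → (∀ i p → Dec (P i p)) → (∀ i p → P (suc i) p → P i p) →
  (∀ i p → e ≤ i → P i p → P (suc i) p) → HornLev T h P (Inhabited e true) → ChainLevels T h e true
T-chain {h} {e} P P? antitone constant horn = record
  { P = P ; P? = P? ; horn = horn
  ; successor  = reflexive-successor {T} antitone constant (λ _ → inj₁ refl) (λ _ → inj₂ (inj₁ refl)) bound-T
  ; represents = λ s j st → toℕ j , level s j st , inj₁ tt , λ _ → ⇔-refl
  }
  where
  bound-T : ∀ j k → k ≤ e → Acc T e true j k → k ≤ suc j
  bound-T j k _ (inj₁ refl)                     = n≤1+n k
  bound-T j k _ (inj₂ (inj₁ refl))              = ≤-refl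
  bound-T j k _ (inj₂ (inj₂ (_ , refl , refl))) = n≤1+n k
  level : ∀ s (j : Fin (suc e)) → Steps (closeL T (chain e true)) s zero j → toℕ j ≤ s
  level zero    j refl         = z≤n
  level (suc s) j (u , st , r) =
    ≤-trans (bound-T (toℕ u) (toℕ j) (toℕ≤pred[n] j) (to (closeL⇔Acc T) r)) (s≤s (level s u st))

-- The letters do not change after level 1, so world 1 stands for all later levels.
S4-chain : ∀ {h} (P : Letters) → (∀ i p → Dec (P i p)) → (∀ i p → P (suc i) p → P i p) →
  (∀ i p → 1 ≤ i → P i p → P (suc i) p) → HornLev S4 h P (Inhabited 1 true) → ChainLevels S4 h 1 true
S4-chain P P? antitone constant horn = record
  { P = P ; P? = P? ; horn = horn
  ; successor  = reflexive-successor {S4} antitone constant (λ _ → ≤-refl) n≤1+n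
                   (λ _ _ k≤1 _ → ≤-trans k≤1 (s≤s z≤n))
  ; represents = λ s j st → toℕ j , (λ { refl → cong toℕ (sym st) }) , inj₁ tt , λ _ → ⇔-refl
  }

-- After a dead end the levels are empty and satisfy every letter vacuously. With a loop the letters
-- stop growing at `e`, and `1 ≤ e` because monotonicity starts only at level 1.
Tail : Bool → ℕ → Letters → Set
Tail false e P = ∀ i p → e < i → P i p
Tail true  e P = 1 ≤ e × (∀ i p → e ≤ i → P (suc i) p → P i p)

-- In a transitive frame a path of at least two steps can be shortened by one, so from 1 on the
-- levels shrink and their common letters grow; level 0, the root alone, need not be comparable with
-- level 1.
record K4Levels (h : HornBox) (b : Bool) (e : ℕ) : Set₁ where
  field
    P    : Letters
    P?   : ∀ i p → Dec (P i p)
    mono : ∀ i p → 1 ≤ i → P i p → P (suc i) p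
    tail : Tail b e P
    horn : HornLev K4 h P (Inhabited e b)

  lev-mono : ∀ {i} λ′ → 1 ≤ i → lev P i λ′ → lev P (suc i) λ′
  lev-mono {i} λ′ 1≤i = lev-suc λ′ λ d p → mono (d + i) p (≤-trans 1≤i (m≤n+m i d))

  lev-mono-≤ : ∀ {i j} λ′ → 1 ≤ i → i ≤ j → lev P i λ′ → lev P j λ′
  lev-mono-≤ {i} λ′ 1≤i i≤j l with ≤⇒∃ i≤j
  ... | d , refl = ascend d
    where
    ascend : ∀ d → lev P (d + i) λ′
    ascend zero    = l
    ascend (suc d) = lev-mono λ′ (≤-trans 1≤i (m≤n+m i d)) (ascend d)

K4-chain : ∀ {h b e} → K4Levels h b e → ChainLevels K4 h e b
K4-chain {h} {b} {e} C = record
  { P = P ; P? = P? ; horn = horn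
  ; successor  = λ j j≤e λ′ → mk⇔ (next b tail j j≤e λ′) (previous b tail j λ′)
  ; represents = λ s j st → representative s j (position s j st)
  }
  where
  open K4Levels C
  next : ∀ b → Tail b e P → ∀ j → j ≤ e → ∀ λ′ →
    (∀ k → k ≤ e → Acc K4 e b j k → lev P k λ′) → lev P (suc j) λ′
  next b tail j j≤e λ′ f with m≤n⇒m<n∨m≡n j≤e
  ... | inj₁ j<e = f (suc j) j<e (inj₁ ≤-refl)
  next false above       j j≤e λ′ f | inj₂ refl = lev-above λ′ above ≤-refl
  next true  (1≤e , _)   j j≤e λ′ f | inj₂ refl = lev-mono λ′ 1≤e (f e ≤-refl (inj₂ (tt , refl , refl)))
  constant : ∀ {i} λ′ → Tail true e P → e ≤ i → lev P (suc i) λ′ → lev P i λ′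
  constant {i} λ′ (_ , const) e≤i = lev-pred λ′ λ d p → const (d + i) p (≤-trans e≤i (m≤n+m i d))
  previous : ∀ b → Tail b e P → ∀ j λ′ → lev P (suc j) λ′ → ∀ k → k ≤ e → Acc K4 e b j k → lev P k λ′
  previous b    tail j λ′ l k _ (inj₁ j<k)                = lev-mono-≤ λ′ (s≤s z≤n) j<k l
  previous true tail j λ′ l k _ (inj₂ (_ , refl , refl))  = constant λ′ tail ≤-refl l
  -- Steps off the loop raise the index, so `s` of them lead to an index of at least `s`; a path
  -- that uses the loop ends at `e`.
  Position : ℕ → Fin (suc e) → Set
  Position s j = (s ≡ 0 × toℕ j ≡ 0) ⊎ (1 ≤ s × (s ≤ toℕ j ⊎ (True b × toℕ j ≡ e)))
  position : ∀ s j → Steps (closeL K4 (chain e b)) s zero j → Position s j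
  position zero    j refl         = inj₁ (refl , refl)
  position (suc s) j (u , st , r) with to (closeL⇔Acc K4) r
  ... | inj₂ (tb , _ , j≡e) = inj₂ (s≤s z≤n , inj₂ (tb , j≡e))
  ... | inj₁ u<j with position s u st
  ...   | inj₁ (refl , _)             = inj₂ (s≤s z≤n , inj₁ (≤-trans (s≤s z≤n) u<j))
  ...   | inj₂ (_ , inj₁ s≤u)         = inj₂ (s≤s z≤n , inj₁ (≤-trans (s≤s s≤u) u<j))
  ...   | inj₂ (_ , inj₂ (_ , u≡e))   = contradiction (subst (_< toℕ j) u≡e u<j) (≤⇒≯ (toℕ≤pred[n] j))
  eventually : ∀ b → Tail b e P → True b → ∀ s λ′ → lev P e λ′ ⇔ lev P (s + e) λ′
  eventually b    tail tb zero    λ′ = ⇔-refl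
  eventually true tail tb (suc s) λ′ = ⇔-trans (eventually true tail tb s λ′)
    (mk⇔ (lev-mono λ′ (≤-trans (proj₁ tail) (m≤n+m e s))) (constant λ′ tail (m≤n+m e s)))
  representative : ∀ s j → Position s j →
    Σ ℕ λ i → Range K4 s i × Inhabited e b i × (∀ λ′ → lev P (toℕ j) λ′ ⇔ lev P i λ′)
  representative s j (inj₁ (s≡0 , j≡0)) =
    toℕ j , inj₁ (s≡0 , j≡0) , inj₂ (toℕ≤pred[n] j) , λ _ → ⇔-refl
  representative s j (inj₂ (1≤s , inj₁ s≤j)) =
    toℕ j , inj₂ (1≤s , s≤j) , inj₂ (toℕ≤pred[n] j) , λ _ → ⇔-refl
  representative s j (inj₂ (1≤s , inj₂ (tb , j≡e))) =
    -- Level `s + e` is late enough for the range of `s` boxes, and from `e` on all levels satisfy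
    -- the same literals.
    s + e , inj₂ (1≤s , m≤m+n s e) , inj₁ tb ,
    λ λ′ → subst (λ n → lev P n λ′ ⇔ lev P (s + e) λ′) (sym j≡e) (eventually b tail tb s λ′)

-- Deleting levels of a transitive chain

-- The increasing enumeration of all levels but `g`; composing `P` with it deletes level `g`.
skip : ℕ → ℕ → ℕ
skip g i with i <? g
... | yes _ = i
... | no  _ = suc i

skip-< : ∀ {g i} → i < g → skip g i ≡ i
skip-< {g} {i} i<g with i <? g
... | yes _   = refl
... | no  i≮g = contradiction i<g i≮g

skip-≥ : ∀ {g i} → g ≤ i → skip g i ≡ suc i
skip-≥ {g} {i} g≤i with i <? g
... | yes i<g = contradiction g≤i (<⇒≱ i<g)
... | no  _   = refl

weight : Clause → ℕ
weight c = sum (map depth (Clause.negs c))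

∈⇒≤sum : ∀ (f : BPLit → ℕ) {x xs} → x ∈ xs → f x ≤ sum (map f xs)
∈⇒≤sum f (here refl)             = m≤m+n _ _
∈⇒≤sum f {xs = y ∷ _} (there x∈) = ≤-trans (∈⇒≤sum f x∈) (m≤n+m _ (f y))

module _ {h b e} (C : K4Levels h b (suc e)) where
  open K4Levels C

  module _ {g} (1≤g : 1 ≤ g) where

    private
      P′ : Letters
      P′ i = P (skip g i)

    -- By monotonicity the shortened sequence lies, from level 1 on, between the old one and the old
    -- one shifted by one level. It equals the former before `g` and the latter from `g` on. This
    -- and the next three lemmas transfer these comparisons to literals.
    old⇒new : ∀ {i} λ′ → lev P i λ′ → lev P′ i λ′
    old⇒new {i} λ′ = lev-map λ′ λ p → step (depth λ′ + i) p
      where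
      step : ∀ j p → P j p → P′ j p
      step j p x with j <? g
      ... | yes _   = x
      ... | no  j≮g = mono j p (≤-trans 1≤g (≮⇒≥ j≮g)) x

    new⇒old : ∀ {i} λ′ → depth λ′ + i < g → lev P′ i λ′ → lev P i λ′
    new⇒old λ′ below = lev-map λ′ λ p → subst (λ j → P j p) (skip-< below)

    new⇒old-suc : ∀ {i} λ′ → 1 ≤ i → lev P′ i λ′ → lev P (suc i) λ′
    new⇒old-suc {i} λ′ 1≤i = lev-map λ′ λ p x →
      subst (λ m → P m p) (sym (+-suc (depth λ′) i)) (step (depth λ′ + i) p (≤-trans 1≤i (m≤n+m i _)) x)
      where
      step : ∀ j p → 1 ≤ j → P′ j p → P (suc j) p
      step j p 1≤j x with j <? g
      ... | yes _ = mono j p 1≤j x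
      ... | no  _ = x

    old-suc⇒new : ∀ {i} λ′ → g ≤ depth λ′ + i → lev P (suc i) λ′ → lev P′ i λ′
    old-suc⇒new {i} λ′ above = lev-map λ′ λ p x →
      subst (λ m → P m p) (trans (+-suc (depth λ′) i) (sym (skip-≥ above))) x

  -- A clause with head □^c r can only fail after deleting g if the head starts to hold between two
  -- consecutive levels i and i+1 and i+c < g ≤ i+a for some body literal □^a p; by monotonicity i is unique.
  Flip : BPLit → ℕ → Set
  Flip λ′ i = 1 ≤ i × ¬ lev P i λ′ × lev P (suc i) λ′

  flip-unique : ∀ λ′ {i j} → Flip λ′ i → Flip λ′ j → i ≡ j
  flip-unique λ′ {i} {j} (_ , ¬i , yes-i) (_ , ¬j , yes-j) with <-cmp i j
  ... | tri< i<j _ _ = contradiction (lev-mono-≤ λ′ (s≤s z≤n) i<j yes-i) ¬j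
  ... | tri≈ _ i≡j _ = i≡j
  ... | tri> _ _ j<i = contradiction (lev-mono-≤ λ′ (s≤s z≤n) j<i yes-j) ¬i

  Deletable : Clause → ℕ → Set
  Deletable c g = ∀ i → Range K4 (Clause.boxes c) i → ClauseAt (λ j → P (skip g j)) (Inhabited e b) i c

  inhabited-mono : ∀ {i} → Inhabited e b i → Inhabited (suc e) b i
  inhabited-mono (inj₁ tb)  = inj₁ tb
  inhabited-mono (inj₂ i≤e) = inj₂ (m≤n⇒m≤1+n i≤e)

  inhabited-suc : ∀ {i} → Inhabited e b i → Inhabited (suc e) b (suc i)
  inhabited-suc (inj₁ tb)  = inj₁ tb
  inhabited-suc (inj₂ i≤e) = inj₂ (s≤s i≤e)

  interval : ℕ → ℕ → List ℕ
  interval m w = map (m +_) (upTo w)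

  ∉-interval : ∀ {m w g} → m ≤ g → g ∉ interval m w → m + w ≤ g
  ∉-interval {m} {w} {g} m≤g g∉ with g <? m + w
  ... | no  g≮ = ≮⇒≥ g≮
  ... | yes g< with m≤n⇒∃[o]m+o≡n m≤g
  ...   | d , refl = contradiction (∈-map⁺ (m +_) (∈-upTo⁺ (+-cancelˡ-< m d w g<))) g∉

  length-interval : ∀ m w → length (interval m w) ≤ w
  length-interval m w = ≤-reflexive (trans (length-map (m +_) (upTo w)) (length-upTo w))

  -- The list collects the levels whose deletion the clause may prevent. Whether its head flips
  -- somewhere is undecidable, whence the double negation.
  deletable : ∀ {c} → c ∈ h → ¬ ¬ Σ (List ℕ) λ xs → length xs ≤ weight c × (∀ g → 1 ≤ g → g ∉ xs → Deletable c g)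
  deletable {c@(clause zero ns pos)} c∈h k = k (interval 1 (weight c) , length-interval 1 (weight c) , root)
    where
    root : ∀ g → 1 ≤ g → g ∉ interval 1 (weight c) → Deletable c g
    -- A clause without outer boxes speaks of level 0 only, and its negated literals look at most
    -- `weight c` levels ahead, where nothing has changed.
    root g 1≤g g∉ i (inj₁ (_ , refl)) body = head pos (horn c∈h 0 (inj₁ (refl , refl))
        λ {λ′} λ∈ → new⇒old 1≤g λ′ (below λ′ λ∈) (body λ∈))
      where
      below : ∀ λ′ → λ′ ∈ ns → depth λ′ + 0 < g
      below λ′ λ∈ = ≤-trans (s≤s (subst (_≤ weight c) (sym (+-identityʳ _)) (∈⇒≤sum depth λ∈)))
                            (∉-interval 1≤g g∉)
      head : ∀ pos → Head P (Inhabited (suc e) b) 0 pos → Head (λ j → P (skip g j)) (Inhabited e b) 0 pos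
      head nothing   ¬inh inh = ¬inh (inhabited-mono inh)
      head (just λ′) l        = old⇒new 1≤g λ′ l
  -- A body true at the new level `i` is true at the old level `suc i`, so that level is
  -- uninhabited, and with it the new level `i`; nothing is forbidden.
  deletable {c@(clause (suc s) ns nothing)} c∈h k = k ([] , z≤n , λ
    { g 1≤g _ i (inj₂ (1≤s , s≤i)) body inh → horn c∈h (suc i) (inj₂ (1≤s , m≤n⇒m≤1+n s≤i))
        (λ {λ′} λ∈ → new⇒old-suc 1≤g λ′ (≤-trans 1≤s s≤i) (body λ∈)) (inhabited-suc inh) })
  deletable {c@(clause (suc s) ns (just κ))} c∈h k = ¬¬-excluded-middle λ
    { (no ¬flip) → k ([] , z≤n , λ { g 1≤g _ i (inj₂ (1≤s , s≤i)) body →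
        by-contradiction g i λ ¬new → ¬flip (i , flip g 1≤g i 1≤s s≤i body ¬new) })
    ; (yes (i₀ , flip₀)) → k (interval (suc (depth κ + i₀)) (weight c) , length-interval _ (weight c) ,
        λ { g 1≤g g∉ i (inj₂ (1≤s , s≤i)) body → by-contradiction g i λ ¬new →
          let flipᵢ = flip g 1≤g i 1≤s s≤i body ¬new
              i≡i₀  = flip-unique κ flipᵢ flip₀
              -- For smaller `g` the new head at `i` is the old head at `suc i`, which holds.
              κ<g   = ≰⇒> λ g≤ → ¬new (old-suc⇒new 1≤g κ g≤ (proj₂ (proj₂ flipᵢ)))
              far   = ∉-interval (subst (λ m → depth κ + m < g) i≡i₀ κ<g) g∉
          -- Past the interval the body sees only unchanged letters, so it held at the old level `i`
          -- and forced the head there, against the flip.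
          in proj₁ (proj₂ flipᵢ) (horn c∈h i (inj₂ (1≤s , s≤i)) λ {λ′} λ∈ →
               new⇒old 1≤g λ′ (below (subst (λ m → suc (depth κ + m) + weight c ≤ g) (sym i≡i₀) far) λ∈) (body λ∈)) }) }
    where
    by-contradiction : ∀ g i → ¬ ¬ lev (λ j → P (skip g j)) i κ → lev (λ j → P (skip g j)) i κ
    by-contradiction g i = decidable-stable (lev-dec (λ j → P? (skip g j)) i κ)
    flip : ∀ g → 1 ≤ g → ∀ i → 1 ≤ suc s → suc s ≤ i →
      (∀ {λ′} → λ′ ∈ ns → lev (λ j → P (skip g j)) i λ′) → ¬ lev (λ j → P (skip g j)) i κ → Flip κ i
    flip g 1≤g i 1≤s s≤i body ¬new = ≤-trans 1≤s s≤i , ¬new ∘ old⇒new 1≤g κ ,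
      horn c∈h (suc i) (inj₂ (1≤s , m≤n⇒m≤1+n s≤i)) λ {λ′} λ∈ → new⇒old-suc 1≤g λ′ (≤-trans 1≤s s≤i) (body λ∈)
    below : ∀ {i g λ′} → suc (depth κ + i) + weight c ≤ g → λ′ ∈ ns → depth λ′ + i < g
    below {i} {g} {λ′} far λ∈ = ≤-trans (s≤s (≤-trans (+-monoˡ-≤ i (∈⇒≤sum depth λ∈))
      (≤-trans (≤-reflexive (+-comm (weight c) i)) (+-monoˡ-≤ (weight c) (m≤n+m i (depth κ)))))) far

  deletable-all : ∀ cs → (∀ {c} → c ∈ cs → c ∈ h) → ¬ ¬ Σ (List ℕ) λ xs →
    length xs ≤ sum (map weight cs) × (∀ g → 1 ≤ g → g ∉ xs → ∀ {c} → c ∈ cs → Deletable c g)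
  deletable-all []       cs⊆h k = k ([] , z≤n , λ _ _ _ ())
  deletable-all (c ∷ cs) cs⊆h k =
    deletable (cs⊆h (here refl)) λ (xs , ∣xs∣ , del) →
    deletable-all cs (cs⊆h ∘ there) λ (ys , ∣ys∣ , dels) →
    k (xs ++ ys , ≤-trans (≤-reflexive (length-++ xs)) (+-mono-≤ ∣xs∣ ∣ys∣) , λ
      { g 1≤g g∉ (here refl) → del g 1≤g (g∉ ∘ ∈-++⁺ˡ)
      ; g 1≤g g∉ (there c∈)  → dels g 1≤g (g∉ ∘ ∈-++⁺ʳ xs) c∈ })

  -- Level 0 and the last level `suc e` are kept, which leaves `e` candidates; the clauses together
  -- forbid fewer than `e`.
  delete : 1 ≤ e → sum (map weight h) < e → ¬ ¬ K4Levels h b e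
  delete 1≤e w<e k = deletable-all h id λ (xs , ∣xs∣ , del) → shorten (∃-∉ e xs (≤-<-trans ∣xs∣ w<e)) del
    where
    tail-skip : ∀ {g} → g ≤ e → ∀ b → Tail b (suc e) P → Tail b e (λ j → P (skip g j))
    tail-skip g≤e false above i p e<i =
      subst (λ m → P m p) (sym (skip-≥ (≤-trans g≤e (<⇒≤ e<i)))) (above (suc i) p (s≤s e<i))
    tail-skip g≤e true (_ , const) = 1≤e , λ i p e≤i x →
      subst (λ m → P m p) (sym (skip-≥ (≤-trans g≤e e≤i)))
        (const (suc i) p (s≤s e≤i) (subst (λ m → P m p) (skip-≥ (≤-trans g≤e (m≤n⇒m≤1+n e≤i))) x))
    mono-skip : ∀ g i p → 1 ≤ i → P (skip g i) p → P (skip g (suc i)) p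
    mono-skip g i p 1≤i x with i <? g | suc i <? g
    ... | yes _   | yes _     = mono i p 1≤i x
    ... | yes _   | no  _     = mono (suc i) p (s≤s z≤n) (mono i p 1≤i x)
    ... | no  _   | no  _     = mono (suc i) p (s≤s z≤n) x
    ... | no  i≮g | yes 1+i<g = contradiction (≤-trans (n≤1+n (suc i)) 1+i<g) i≮g
    shorten : ∀ {xs} → (Σ ℕ λ g → 1 ≤ g × g ≤ e × g ∉ xs) →
      (∀ g → 1 ≤ g → g ∉ xs → ∀ {c} → c ∈ h → Deletable c g) → ⊥
    shorten (g , 1≤g , g≤e , g∉xs) del = k record
      { P    = λ j → P (skip g j)
      ; P?   = λ j → P? (skip g j)
      ; mono = mono-skip g
      ; tail = tail-skip g≤e b tail
      ; horn = del g 1≤g g∉xs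
      }

-- The 2 counts the first and the last level, which are never deleted.
shrink : ∀ {h b} n → sum (map weight h) + 2 ≤ n → ∀ e → K4Levels h b e → ¬ ¬ (Σ ℕ λ e′ → e′ < n × K4Levels h b e′)
shrink n w e       C k with e <? n
shrink n w e       C k | yes e<n = k (e , e<n , C)
shrink n w zero    C k | no  e≮n = e≮n (≤-trans (s≤s z≤n) (≤-trans (m≤n+m 2 _) w))
shrink {h} n w (suc e) C k | no  e≮n = delete C (≤-trans (s≤s z≤n) w<e) w<e λ C′ → shrink n w e C′ k
  where
  w<e : sum (map weight h) < e
  w<e = s≤s⁻¹ (≤-trans (≤-reflexive (+-comm 2 _)) (≤-trans w (≮⇒≥ e≮n)))

-- Extracting levels from a model

module _ (M : Model) (w : W M) where

  Level : ℕ → Set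
  Level i = Σ (W M) (Steps (R M) i w)

  Common : Letters
  Common i p = ∀ v → Steps (R M) i w v → V M v p

  -- Box positive literals contain neither negation nor disjunction: quantifying over a level and
  -- then over successors is quantifying over the next level.
  common-truth : ∀ i λ′ → (∀ v → Steps (R M) i w v → M , v ⊨ ⟦ λ′ ⟧λ) ⇔ lev Common i λ′
  common-truth i top      = mk⇔ (λ _ → tt) (λ _ _ _ → tt)
  common-truth i (lit p)  = ⇔-refl
  common-truth i (box λ′) = ⇔-trans
    (mk⇔ (λ { sat u (v , st , Rvu) → sat v st u Rvu }) (λ sat v st u Rvu → sat u (v , st , Rvu)))
    (common-truth (suc i) λ′)

  level-pred : ∀ {i} → Level (suc i) → Level i
  level-pred (_ , u , st , _) = u , st

  level-≤ : ∀ {i j} → i ≤ j → Level j → Level i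
  level-≤ {i} i≤j l with ≤⇒∃ i≤j
  ... | d , refl = descend d l
    where
    descend : ∀ d → Level (d + i) → Level i
    descend zero    l = l
    descend (suc d) l = descend d (level-pred l)

  steps-pad : (∀ v → R M v v) → ∀ {i v} d → Steps (R M) i w v → Steps (R M) (d + i) w v
  steps-pad r zero    st = st
  steps-pad r (suc d) st = _ , steps-pad r d st , r _

  -- Transitivity merges the last two steps, so at least one step must remain.
  steps-drop : (∀ {u v x} → R M u v → R M v x → R M u x) →
    ∀ {i v} d → 1 ≤ i → Steps (R M) (d + i) w v → Steps (R M) i w v
  steps-drop t zero    1≤i st = st
  steps-drop t {suc i} (suc d) 1≤i st = steps-drop t d 1≤i (merge (+-suc d i) st)
    where
    merge : ∀ {k v} → k ≡ suc (d + i) → Steps (R M) (suc k) w v → Steps (R M) k w v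
    merge refl (_ , (u , st , r) , r′) = u , st , t r r′

  range-steps : ∀ L → FrameCond L (R M) → ∀ {s i v} → Range L s i → Steps (R M) i w v → Steps (R M) s w v
  range-steps K  _ refl                 st = st
  range-steps T  r i≤s                  st with ≤⇒∃ i≤s
  ... | d , refl = steps-pad (λ _ → r) d st
  range-steps K4 t (inj₁ (refl , refl)) st = st
  range-steps K4 t (inj₂ (1≤s , s≤i))   st with ≤⇒∃ s≤i
  ... | d , refl = steps-drop t d 1≤s st
  range-steps S4 (r , t) {zero}      range st with range refl
  ... | refl = st
  range-steps S4 (r , t) {suc s} {i} {v} range st with ≤-total i (suc s)
  ... | inj₂ s≤i with ≤⇒∃ s≤i
  ...   | d , refl = steps-drop t d (s≤s z≤n) st
  range-steps S4 (r , t) {suc s} {i} {v} range st | inj₁ i≤s with ≤⇒∃ i≤s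
  ...   | d , eq = subst (λ k → Steps (R M) k w v) (sym eq) (steps-pad (λ _ → r) d st)

  -- This is where the Horn shape enters: if the body holds throughout a level, every negated
  -- disjunct is refuted at each of its worlds, and at most one disjunct is left, the same for all
  -- of them.
  common-horn : ∀ L h → FrameCond L (R M) → M , w ⊨ ⟦ h ⟧h → HornLev L h Common Level
  common-horn L h fc sat {clause s ns pos} c∈h i range body =
      head pos λ v st → ⋁⁻ _ (to (⊨□^ s _) (⋀⁻ (map ⟦_⟧c h) sat (∈-map⁺ ⟦_⟧c c∈h)) v
                                  (range-steps L fc range st))
    where
    refuted : ∀ {v ψ} → Steps (R M) i w v → ψ ∈ map (λ λ′ → ¬' ⟦ λ′ ⟧λ) ns → ¬ (M , v ⊨ ψ)
    refuted st ψ∈ with ∈-map⁻ _ ψ∈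
    ... | λ′ , λ∈ , refl = λ ¬lit → ¬lit (from (common-truth i λ′) (body λ∈) _ st)
    head : ∀ pos → (∀ v → Steps (R M) i w v →
        Σ Fm λ ψ → ψ ∈ map (λ λ′ → ¬' ⟦ λ′ ⟧λ) ns ++ posList pos × (M , v ⊨ ψ)) →
      Head Common Level i pos
    head pos disj with pos
    ... | nothing = λ (v , st) → let (ψ , ψ∈ , sat-ψ) = disj v st in
            [ (λ ψ∈ns → refuted st ψ∈ns sat-ψ) , (λ ()) ]′ (∈-++⁻ (map _ ns) ψ∈)
    ... | just λ′ = to (common-truth i λ′) λ v st → positive st (disj v st)
      where
      positive : ∀ {v} → Steps (R M) i w v →
        (Σ Fm λ ψ → ψ ∈ map (λ λ′ → ¬' ⟦ λ′ ⟧λ) ns ++ ⟦ λ′ ⟧λ ∷ [] × (M , v ⊨ ψ)) → M , v ⊨ ⟦ λ′ ⟧λ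
      positive st (ψ , ψ∈ , sat-ψ) with ∈-++⁻ (map _ ns) ψ∈
      ... | inj₁ ψ∈ns        = ⊥-elim (refuted st ψ∈ns sat-ψ)
      ... | inj₂ (here refl) = sat-ψ

data LitOf (c : Clause) (λ′ : BPLit) : Set where
  neg : λ′ ∈ Clause.negs c → LitOf c λ′
  pos : Clause.pos c ≡ just λ′ → LitOf c λ′

-- Inhabitation occurs only negated, in headless clauses, so it has to be transferred only up to
-- double negation.
hornLev-cong : ∀ {L h P Q N N′} →
  (∀ {c} → c ∈ h → ∀ {i} → Range L (Clause.boxes c) i → ∀ {λ′} → LitOf c λ′ → lev P i λ′ ⇔ lev Q i λ′) →
  (∀ i → N′ i → ¬ ¬ N i) → HornLev L h P N → HornLev L h Q N′
hornLev-cong {P = P} {Q} {N} {N′} agree inh horn {c} c∈h i range body =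
    head (Clause.pos c) refl (horn c∈h i range λ λ∈ → from (agree c∈h range (neg λ∈)) (body λ∈))
  where
  head : ∀ p → Clause.pos c ≡ p → Head P N i p → Head Q N′ i p
  head nothing   _  ¬n n′ = inh i n′ ¬n
  head (just λ′) eq l     = to (agree c∈h range (pos eq)) l

-- Sizes and modal depths

md-□^ : ∀ s φ → md (□^ s φ) ≡ s + md φ
md-□^ zero    φ = refl
md-□^ (suc s) φ = cong suc (md-□^ s φ)

md-⋁ : ∀ {ψ} φs → ψ ∈ φs → md ψ ≤ md (⋁ φs)
md-⋁ (φ ∷ [])     (here refl) = ≤-refl
md-⋁ (φ ∷ χ ∷ φs) (here refl) = m≤m⊔n (md φ) _
md-⋁ (φ ∷ χ ∷ φs) (there ψ∈)  = ≤-trans (md-⋁ (χ ∷ φs) ψ∈) (m≤n⊔m (md φ) _)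

md-⋀ : ∀ {ψ} φs → ψ ∈ φs → md ψ ≤ md (⋀ φs)
md-⋀ (φ ∷ [])     (here refl) = ≤-refl
md-⋀ (φ ∷ χ ∷ φs) (here refl) = m≤m⊔n (md φ) _
md-⋀ (φ ∷ χ ∷ φs) (there ψ∈)  = ≤-trans (md-⋀ (χ ∷ φs) ψ∈) (m≤n⊔m (md φ) _)

depth-bound : ∀ {h c λ′} → c ∈ h → LitOf c λ′ → depth λ′ + Clause.boxes c ≤ md ⟦ h ⟧h
depth-bound {h} {c@(clause s ns p)} {λ′} c∈h lit∈c = begin
  depth λ′ + s      ≤⟨ +-monoˡ-≤ s (in-disjunction lit∈c) ⟩
  md (disj ns p) + s ≡⟨ +-comm _ s ⟩
  s + md (disj ns p) ≡⟨ md-□^ s (disj ns p) ⟨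
  md ⟦ c ⟧c          ≤⟨ md-⋀ (map ⟦_⟧c h) (∈-map⁺ ⟦_⟧c c∈h) ⟩
  md ⟦ h ⟧h          ∎
  where
  open ≤-Reasoning
  in-disjunction : LitOf c λ′ → depth λ′ ≤ md (disj ns p)
  in-disjunction (neg λ∈)   = md-⋁ {¬' ⟦ λ′ ⟧λ} _ (∈-++⁺ˡ (∈-map⁺ _ λ∈))
  in-disjunction (pos refl) = md-⋁ _ (∈-++⁺ʳ (map _ ns) (here refl))

1≤size : ∀ φ → 1 ≤ size φ
1≤size ⊤'       = ≤-refl
1≤size ⊥'       = ≤-refl
1≤size (var _)  = ≤-refl
1≤size (¬' _)   = s≤s z≤n
1≤size (_ ∧' _) = s≤s z≤n
1≤size (_ ∨' _) = s≤s z≤n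
1≤size (□ _)    = s≤s z≤n

size-□^ : ∀ s φ → size φ ≤ size (□^ s φ)
size-□^ zero    φ = ≤-refl
size-□^ (suc s) φ = m≤n⇒m≤1+n (size-□^ s φ)

size-lit : ∀ λ′ → size ⟦ λ′ ⟧λ ≡ suc (depth λ′)
size-lit top      = refl
size-lit (lit _)  = refl
size-lit (box λ′) = cong suc (size-lit λ′)

-- The `suc` covers the singleton, in which the `⊥'` of the empty disjunction disappears.
size-⋁-∷ : ∀ φ φs → size φ + size (⋁ φs) ≤ suc (size (⋁ (φ ∷ φs)))
size-⋁-∷ φ []       = ≤-reflexive (+-comm (size φ) 1)
size-⋁-∷ φ (_ ∷ _)  = m≤n⇒m≤1+n (n≤1+n _)

size-⋀-∷ : ∀ φ φs → size φ + size (⋀ φs) ≤ suc (size (⋀ (φ ∷ φs)))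
size-⋀-∷ φ []       = ≤-reflexive (+-comm (size φ) 1)
size-⋀-∷ φ (_ ∷ _)  = m≤n⇒m≤1+n (n≤1+n _)

mutual
  size-disj : ∀ ns p → suc (sum (map depth ns)) ≤ size (disj ns p)
  size-disj []       p = 1≤size (disj [] p)
  size-disj (n ∷ ns) p = ≤-trans (n≤1+n _) (size-disj-∷ n ns p)

  size-disj-∷ : ∀ n ns p → 2 + sum (map depth (n ∷ ns)) ≤ size (disj (n ∷ ns) p)
  size-disj-∷ n ns p = s≤s⁻¹ (begin
    3 + (depth n + sum (map depth ns))            ≡⟨ cong (2 +_) (+-suc (depth n) _) ⟨
    2 + depth n + suc (sum (map depth ns))        ≡⟨ cong (λ k → suc k + _) (size-lit n) ⟨
    size (¬' ⟦ n ⟧λ) + suc (sum (map depth ns))   ≤⟨ +-monoʳ-≤ (size (¬' ⟦ n ⟧λ)) (size-disj ns p) ⟩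
    size (¬' ⟦ n ⟧λ) + size (disj ns p)           ≤⟨ size-⋁-∷ (¬' ⟦ n ⟧λ) (map (λ λ′ → ¬' ⟦ λ′ ⟧λ) ns ++ posList p) ⟩
    suc (size (disj (n ∷ ns) p))                  ∎)
    where open ≤-Reasoning

size-clause : ∀ c → suc (weight c) ≤ size ⟦ c ⟧c
size-clause (clause s ns p) = ≤-trans (size-disj ns p) (size-□^ s _)

size-horn : ∀ h → suc (sum (map weight h)) ≤ size ⟦ h ⟧h
size-horn []      = ≤-refl
size-horn (c ∷ h) = s≤s⁻¹ (begin
  2 + (weight c + sum (map weight h))     ≡⟨ cong suc (+-suc (weight c) _) ⟨
  suc (weight c) + suc (sum (map weight h)) ≤⟨ +-mono-≤ (size-clause c) (size-horn h) ⟩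
  size ⟦ c ⟧c + size ⟦ h ⟧h               ≤⟨ size-⋀-∷ ⟦ c ⟧c (map ⟦_⟧c h) ⟩
  suc (size ⟦ c ∷ h ⟧h)                   ∎)
  where open ≤-Reasoning

-- The two extra symbols come from a literal and its negation sign, or from the separate symbols of
-- two clauses; if there is a single clause and it has no negated literal, the weight is 0 and size
-- 2 is enough.
weight-bound : ∀ h → 2 ≤ size ⟦ h ⟧h → sum (map weight h) + 2 ≤ size ⟦ h ⟧h
weight-bound []                              2≤ = 2≤
weight-bound (clause s []       p ∷ [])      2≤ = 2≤
weight-bound (clause s (n ∷ ns) p ∷ [])      2≤ = begin
  sum (map depth (n ∷ ns)) + 0 + 2  ≡⟨ cong (_+ 2) (+-identityʳ _) ⟩
  sum (map depth (n ∷ ns)) + 2      ≡⟨ +-comm _ 2 ⟩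
  2 + sum (map depth (n ∷ ns))      ≤⟨ size-disj-∷ n ns p ⟩
  size (disj (n ∷ ns) p)            ≤⟨ size-□^ s _ ⟩
  size (□^ s (disj (n ∷ ns) p))     ∎
  where open ≤-Reasoning
weight-bound (c ∷ d ∷ h)                     2≤ = begin
  weight c + sum (map weight (d ∷ h)) + 2   ≡⟨ +-comm _ 2 ⟩
  2 + weight c + sum (map weight (d ∷ h))   ≡⟨ +-suc (suc (weight c)) _ ⟨
  suc (weight c) + suc (sum (map weight (d ∷ h))) ≤⟨ +-mono-≤ (size-clause c) (size-horn (d ∷ h)) ⟩
  size ⟦ c ⟧c + size ⟦ d ∷ h ⟧h             ≤⟨ n≤1+n _ ⟩
  size ⟦ c ∷ d ∷ h ⟧h                       ∎
  where open ≤-Reasoning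

-- Such a formula is `⊤'`, `⊥'` or a letter, and if satisfiable it holds at a single world where all
-- letters are true. For K4 and S4 its bound is 1, too small for a chain whose loop sits at level 1.
size≤1⇒preLinSat : ∀ {L k} φ → size φ ≤ 1 → 1 ≤ k → Satisfiable L φ → PreLinSatBounded L φ k
size≤1⇒preLinSat {L} φ small 1≤k (_ , _ , _ , sat) =
  1 , 1≤k , chain 0 false , chain-preLinear 0 false , (λ _ _ → ⊤) , zero , holds φ small sat
  where
  1≰0 : ∀ ψ → ¬ (size ψ ≤ 0)
  1≰0 ψ ψ≤0 = contradiction (≤-trans (1≤size ψ) ψ≤0) λ ()
  holds : ∀ {M w} φ → size φ ≤ 1 → M , w ⊨ φ → model (Fin 1) (closeL L (chain 0 false)) (λ _ _ → ⊤) , zero ⊨ φ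
  holds ⊤'       _       _ = tt
  holds (var _)  _       _ = tt
  holds (¬' φ)   (s≤s s) _ = ⊥-elim (1≰0 φ s)
  holds (φ ∧' ψ) (s≤s s) _ = ⊥-elim (1≰0 φ (≤-trans (m≤m+n _ _) s))
  holds (φ ∨' ψ) (s≤s s) _ = ⊥-elim (1≰0 φ (≤-trans (m≤m+n _ _) s))
  holds (□ φ)    (s≤s s) _ = ⊥-elim (1≰0 φ s)

-- Truncating the sequence of levels

last : ∀ {Q : ℕ → Set} m → Q 0 → (∀ i → i < suc m → Dec (Q i)) →
  Σ ℕ λ e → e ≤ m × Q e × (e ≡ m ⊎ ¬ Q (suc e))
last zero    q₀ Q? = 0 , z≤n , q₀ , inj₁ refl
last (suc m) q₀ Q? with last m q₀ (λ i i<m → Q? i (m≤n⇒m≤1+n i<m))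
... | e , e≤m , q , inj₂ ¬q  = e , m≤n⇒m≤1+n e≤m , q , inj₂ ¬q
... | e , e≤m , q , inj₁ refl with Q? (suc m) ≤-refl
...   | yes q′ = suc m , ≤-refl , q′ , inj₁ refl
...   | no  ¬q = e , n≤1+n m , q , inj₂ ¬q

module _ (M : Model) (w : W M) where

  level-dec : ∀ n → ¬ ¬ (∀ i → i < n → Dec (Level M w i))
  level-dec n = ¬¬-∀< n λ _ _ → ¬¬-excluded-middle

  common-beyond : ∀ {e i} → ¬ Level M w (suc e) → e < i → ∀ p → Common M w i p
  common-beyond ¬lev e<i p v st = ⊥-elim (¬lev (level-≤ M w e<i (v , st)))

  common-antitone : Reflexive (R M) → ∀ i p → Common M w (suc i) p → Common M w i p
  common-antitone r i p x v st = x v (v , st , r)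

  common-mono : Transitive (R M) → ∀ i p → 1 ≤ i → Common M w i p → Common M w (suc i) p
  common-mono t i p 1≤i x v st = x v (steps-drop M w t 1 1≤i st)

  level-refl : Reflexive (R M) → ∀ i → Level M w i
  level-refl r i = w , subst (λ k → Steps (R M) k w w) (+-identityʳ i) (steps-pad M w (λ _ → r) i refl)

BoundedLetters : ℕ → Model → Set
BoundedLetters N M = ∀ v p → N ≤ p → V M v p

common-dec : ∀ {M} N → BoundedLetters N M → ∀ w n → ¬ ¬ (∀ i → i < n → ∀ p → Dec (Common M w i p))
common-dec N bdd w n = ¬¬-∀< n λ i _ → ¬¬-Dec N λ p N≤p v _ → bdd v p N≤p

-- If the range stays below the number of outer boxes, as for K and T, no literal of a clause looks
-- past level `md ⟦ h ⟧h`.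
agree-below : ∀ L h {P Q} → (∀ {s i} → Range L s i → i ≤ s) →
  (∀ {i} p → i ≤ md ⟦ h ⟧h → P i p ⇔ Q i p) →
  ∀ {c} → c ∈ h → ∀ {i} → Range L (Clause.boxes c) i → ∀ {λ′} → LitOf c λ′ → lev P i λ′ ⇔ lev Q i λ′
agree-below L h range≤ eq {c} c∈h {i} range {λ′} lit∈c =
    mk⇔ (lev-map λ′ λ p → to (eq p shallow)) (lev-map λ′ λ p → from (eq p shallow))
  where
  shallow : depth λ′ + i ≤ md ⟦ h ⟧h
  shallow = ≤-trans (+-monoʳ-≤ (depth λ′) (range≤ range)) (depth-bound c∈h lit∈c)

agree-everywhere : ∀ {P Q : Letters} → (∀ i p → P i p ⇔ Q i p) → ∀ {i} λ′ → lev P i λ′ ⇔ lev Q i λ′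
agree-everywhere eq λ′ = mk⇔ (lev-map λ′ λ p → to (eq _ p)) (lev-map λ′ λ p → from (eq _ p))

clip : ℕ → Letters → Letters
clip m P i = P (i ⊓ m)

clip-antitone : ∀ {P} m → (∀ i p → P (suc i) p → P i p) → ∀ i p → clip m P (suc i) p → clip m P i p
clip-antitone {P} m antitone i p x with i <? m
... | yes i<m = subst (λ k → P k p) (sym (m≤n⇒m⊓n≡m (<⇒≤ i<m)))
                  (antitone i p (subst (λ k → P k p) (m≤n⇒m⊓n≡m i<m) x))
... | no  i≮m = subst (λ k → P k p)
                  (trans (m≥n⇒m⊓n≡n (m≤n⇒m≤1+n (≮⇒≥ i≮m))) (sym (m≥n⇒m⊓n≡n (≮⇒≥ i≮m)))) x

clip-constant : ∀ {P} m i p → m ≤ i → clip m P i p → clip m P (suc i) p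
clip-constant {P} m i p m≤i =
  subst (λ k → P k p) (trans (m≥n⇒m⊓n≡n m≤i) (sym (m≥n⇒m⊓n≡n (m≤n⇒m≤1+n m≤i))))

clip-dec : ∀ {P : Letters} m → (∀ i → i < suc m → ∀ p → Dec (P i p)) → ∀ i p → Dec (clip m P i p)
clip-dec m P? i p = P? (i ⊓ m) (s≤s (m⊓n≤n i m)) p

-- The four logics

K-case : ∀ {N} h M w → BoundedLetters N M → M , w ⊨ ⟦ h ⟧h → ¬ ¬ ChainSat K ⟦ h ⟧h (suc (md ⟦ h ⟧h))
K-case {N} h M w bdd sat k =
  level-dec M w (suc (md ⟦ h ⟧h)) λ level? → truncated (last (md ⟦ h ⟧h) (w , refl) level?)
  where
  truncated : (Σ ℕ λ e → e ≤ md ⟦ h ⟧h × Level M w e × (e ≡ md ⟦ h ⟧h ⊎ ¬ Level M w (suc e))) → ⊥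
  truncated (e , e≤m , lev-e , end) = common-dec N bdd w (suc e) λ P? →
      k (chainLevels⇒chainSat {h = h} (s≤s e≤m) (K-chain Q (Q? P?) (λ _ _ → inj₁)
        (hornLev-cong (agree-below K h ≤-reflexive agree)
          (λ { i (inj₂ i≤e) ¬lev → ¬lev (level-≤ M w i≤e lev-e) }) (common-horn M w K h tt sat))))
    where
    Q : Letters
    Q i p = e < i ⊎ Common M w i p
    Q? : (∀ i → i < suc e → ∀ p → Dec (Common M w i p)) → ∀ i p → Dec (Q i p)
    Q? P? i p with e <? i
    ... | yes e<i = yes (inj₁ e<i)
    ... | no  e≮i = map′ inj₂ [ (λ e<i → contradiction e<i e≮i) , id ]′ (P? i (s≤s (≮⇒≥ e≮i)) p)
    beyond : ∀ {i} p → i ≤ md ⟦ h ⟧h → e < i → e ≡ md ⟦ h ⟧h ⊎ ¬ Level M w (suc e) → Common M w i p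
    beyond p i≤m e<i (inj₁ refl) = contradiction i≤m (<⇒≱ e<i)
    beyond p i≤m e<i (inj₂ ¬lev) = common-beyond M w ¬lev e<i p
    agree : ∀ {i} p → i ≤ md ⟦ h ⟧h → Common M w i p ⇔ Q i p
    agree p i≤m = mk⇔ inj₂ [ (λ e<i → beyond p i≤m e<i end) , id ]′

T-case : ∀ {N} h M w → BoundedLetters N M → Reflexive (R M) → M , w ⊨ ⟦ h ⟧h →
  ¬ ¬ ChainSat T ⟦ h ⟧h (suc (md ⟦ h ⟧h))
T-case {N} h M w bdd r sat k = common-dec N bdd w (suc m) λ P? →
    k (chainLevels⇒chainSat {h = h} ≤-refl (T-chain (clip m (Common M w)) (clip-dec m P?)
      (clip-antitone m (common-antitone M w r)) (clip-constant {Common M w} m)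
      (hornLev-cong (agree-below T h id agree) (λ i _ ¬lev → ¬lev (level-refl M w r i))
        (common-horn M w T h r sat))))
  where
  m : ℕ
  m = md ⟦ h ⟧h
  agree : ∀ {i} p → i ≤ m → Common M w i p ⇔ clip m (Common M w) i p
  agree {i} p i≤m = subst (λ j → Common M w i p ⇔ Common M w j p) (sym (m≤n⇒m⊓n≡m i≤m)) ⇔-refl

S4-case : ∀ {N} h M w → BoundedLetters N M → Reflexive (R M) × Transitive (R M) → M , w ⊨ ⟦ h ⟧h →
  2 ≤ size ⟦ h ⟧h → ¬ ¬ ChainSat S4 ⟦ h ⟧h (size ⟦ h ⟧h)
S4-case {N} h M w bdd (r , t) sat 2≤size k = common-dec N bdd w 2 λ P? →
    k (chainLevels⇒chainSat {h = h} 2≤size (S4-chain (clip 1 (Common M w)) (clip-dec 1 P?)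
      (clip-antitone 1 (common-antitone M w r)) (clip-constant {Common M w} 1)
      (hornLev-cong (λ _ _ {λ′} _ → agree-everywhere agree λ′) (λ i _ ¬lev → ¬lev (level-refl M w r i))
        (common-horn M w S4 h (r , t) sat))))
  where
  agree : ∀ i p → Common M w i p ⇔ clip 1 (Common M w) i p
  -- Only positive levels are affected, and they contain the same worlds, by inserting and merging
  -- steps.
  agree zero    p = ⇔-refl
  agree (suc i) p rewrite ⊓-zeroʳ i =
    mk⇔ (λ x v st → x v (range-steps M w S4 (r , t) {suc i} {1} (λ ()) st))
        (λ x v st → x v (range-steps M w S4 (r , t) {1} {suc i} (λ ()) st))

-- Each letter either never holds from level 1 on, or holds from some level on; the maximum of these
-- finitely many levels serves for all letters below `n`.
stabilises : ∀ {P : Letters} → (∀ i p → 1 ≤ i → P i p → P (suc i) p) → ∀ n →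
  ¬ ¬ (Σ ℕ λ e → 1 ≤ e × (∀ p → p < n → ∀ i → 1 ≤ i → P i p → P e p))
stabilises mono zero    k = k (1 , ≤-refl , λ _ ())
stabilises {P} mono (suc n) k = stabilises mono n λ (e , 1≤e , below) → ¬¬-excluded-middle λ
  { (no none) → k (e , 1≤e , λ p p<1+n i 1≤i x →
      [ (λ p<n → below p p<n i 1≤i x) , (λ { refl → contradiction (i , 1≤i , x) none }) ]′
        (m≤n⇒m<n∨m≡n (s≤s⁻¹ p<1+n)))
  ; (yes (j , 1≤j , xj)) → k (e ⊔ j , ≤-trans 1≤e (m≤m⊔n e j) , λ p p<1+n i 1≤i x →
      [ (λ p<n → mono-≤ 1≤e (m≤m⊔n e j) (below p p<n i 1≤i x)) , (λ { refl → mono-≤ 1≤j (m≤n⊔m e j) xj }) ]′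
        (m≤n⇒m<n∨m≡n (s≤s⁻¹ p<1+n))) }
  where
  mono-≤ : ∀ {i j p} → 1 ≤ i → i ≤ j → P i p → P j p
  mono-≤ {i} {p = p} 1≤i i≤j x with ≤⇒∃ i≤j
  ... | d , refl = ascend d
    where
    ascend : ∀ d → P (d + i) p
    ascend zero    = x
    ascend (suc d) = mono (d + i) p (≤-trans 1≤i (m≤n+m i d)) (ascend d)

K4-levels : ∀ {N} h M w → BoundedLetters N M → Transitive (R M) → M , w ⊨ ⟦ h ⟧h →
  ¬ ¬ (Σ Bool λ b → Σ ℕ λ e → K4Levels h b e)
-- The distinction is whether some level is empty: then the chain stops at the last inhabited one,
-- otherwise it loops where the letters have stabilised.
K4-levels {N} h M w bdd t sat k = ¬¬-excluded-middle λ
  { (yes finite) → dead-end finite ; (no infinite) → loop infinite }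
  where
  P : Letters
  P = Common M w

  dead-end : (Σ ℕ λ E → ¬ Level M w E) → ⊥
  dead-end (E , ¬lev-E) = level-dec M w (suc E) λ level? → finish (last E (w , refl) level?)
    where
    finish : (Σ ℕ λ e → e ≤ E × Level M w e × (e ≡ E ⊎ ¬ Level M w (suc e))) → ⊥
    finish (_ , _ , lev-e , inj₁ refl) = ¬lev-E lev-e
    finish (e , _ , lev-e , inj₂ ¬lev) = common-dec N bdd w (suc e) λ P? → k (false , e , record
      { P    = P
      ; P?   = P-dec P?
      ; mono = common-mono M w t
      ; tail = λ i p e<i → common-beyond M w ¬lev e<i p
      ; horn = hornLev-cong (λ _ _ _ → ⇔-refl)
                 (λ { i (inj₂ i≤e) ¬lev-i → ¬lev-i (level-≤ M w i≤e lev-e) }) (common-horn M w K4 h t sat)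
      })
      where
      P-dec : (∀ i → i < suc e → ∀ p → Dec (P i p)) → ∀ i p → Dec (P i p)
      P-dec P? i p with e <? i
      ... | yes e<i = yes (common-beyond M w ¬lev e<i p)
      ... | no  e≮i = P? i (s≤s (≮⇒≥ e≮i)) p

  loop : ¬ (Σ ℕ λ E → ¬ Level M w E) → ⊥
  loop infinite = stabilises (common-mono M w t) N λ (e , 1≤e , below) → common-dec N bdd w (suc e) λ P? →
    let stable : ∀ p i → 1 ≤ i → P i p → P e p
        stable p i 1≤i x = [ (λ p<N → below p p<N i 1≤i x) , (λ N≤p v _ → bdd v p N≤p) ]′ (<-≤-connex p N)
        ascend : ∀ {i} p → e ≤ i → P e p → P i p
        ascend p e≤i x v st = let (d , eq) = ≤⇒∃ e≤i in
          x v (steps-drop M w t d 1≤e (subst (λ j → Steps (R M) j w v) eq st))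
    in k (true , e , record
      { P    = P
      -- From `e` on the letters are those of level `e`, so finitely many decisions suffice.
      ; P?   = λ i p → [ (λ i<e → P? i (m≤n⇒m≤1+n i<e) p)
                       , (λ e≤i → map′ (ascend p e≤i) (stable p i (≤-trans 1≤e e≤i)) (P? e ≤-refl p)) ]′
                         (<-≤-connex i e)
      ; mono = common-mono M w t
      ; tail = 1≤e , λ i p e≤i x → ascend p e≤i (stable p (suc i) (s≤s z≤n) x)
      ; horn = hornLev-cong (λ _ _ _ → ⇔-refl) (λ i _ ¬lev → infinite (i , ¬lev)) (common-horn M w K4 h t sat)
      })

K4-case : ∀ {N} h M w → BoundedLetters N M → Transitive (R M) → M , w ⊨ ⟦ h ⟧h →
  2 ≤ size ⟦ h ⟧h → ¬ ¬ ChainSat K4 ⟦ h ⟧h (size ⟦ h ⟧h)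
K4-case h M w bdd t sat 2≤size k = K4-levels h M w bdd t sat λ (b , e , C) →
  shrink (size ⟦ h ⟧h) (weight-bound h 2≤size) e C λ (e′ , e′<size , C′) →
  k (chainLevels⇒chainSat {h = h} e′<size (K4-chain C′))

¬¬-chainSat : ∀ L h → 2 ≤ size ⟦ h ⟧h → Satisfiable L ⟦ h ⟧h → ¬ ¬ ChainSat L ⟦ h ⟧h (bound L ⟦ h ⟧h)
¬¬-chainSat L h 2≤size (M , fc , w , sat) = by-logic L fc
  where
  φ : Fm
  φ = ⟦ h ⟧h
  -- Letters that do not occur in φ are made true everywhere, so that only finitely many are undecided.
  M⁺ : Model
  M⁺ = model (W M) (R M) λ v p → p < vars φ → V M v p
  bdd : BoundedLetters (vars φ) M⁺
  bdd v p N≤p p<N = contradiction N≤p (<⇒≱ p<N)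
  sat⁺ : M⁺ , w ⊨ φ
  sat⁺ = to (⊨-cong (vars φ) (λ v p p<N → mk⇔ (λ x _ → x) λ f → f p<N) φ ≤-refl) sat
  by-logic : ∀ L → FrameCond L (R M) → ¬ ¬ ChainSat L φ (bound L φ)
  by-logic K  fc = K-case h M⁺ w bdd sat⁺
  by-logic T  fc = T-case h M⁺ w bdd fc sat⁺
  by-logic K4 fc = K4-case h M⁺ w bdd fc sat⁺ 2≤size
  by-logic S4 fc = S4-case h M⁺ w bdd fc sat⁺ 2≤size

-- Equivalence of satisfiability with bounded pre-linear satisfiability

closeL-frameCond : ∀ L {A : Set} (S : Rel A 0ℓ) → FrameCond L (closeL L S)
closeL-frameCond K  S = tt
closeL-frameCond T  S = Refl.refl
closeL-frameCond K4 S = Trans._++_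
closeL-frameCond S4 S = ε , _◅◅_

1≤bound : ∀ L φ → 1 ≤ bound L φ
1≤bound K  φ = s≤s z≤n
1≤bound T  φ = s≤s z≤n
1≤bound K4 φ = 1≤size φ
1≤bound S4 φ = 1≤size φ

theorem4p3 : (L : Logic) (h : HornBox) →
    Satisfiable L ⟦ h ⟧h ⇔ PreLinSatBounded L ⟦ h ⟧h (bound L ⟦ h ⟧h)
theorem4p3 L h = mk⇔ shorten forget
  where
  φ : Fm
  φ = ⟦ h ⟧h
  shorten : Satisfiable L φ → PreLinSatBounded L φ (bound L φ)
  shorten sat with 2 ≤? size φ
  ... | yes 2≤size = chainSat⇒preLinSat L φ
          (decidable-stable (chainSat? L φ (bound L φ)) (¬¬-chainSat L h 2≤size sat))
  ... | no  2≰size = size≤1⇒preLinSat φ (s≤s⁻¹ (≰⇒> 2≰size)) (1≤bound L φ) sat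
  forget : PreLinSatBounded L φ (bound L φ) → Satisfiable L φ
  forget (n , _ , S , _ , vs , w , sat) = model (Fin n) (closeL L S) vs , closeL-frameCond L S , w , sat
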